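{- Let $G$ and $H$ be connected graphs with $n(G)\ge 2$ and $n(H)\ge 2$, and let at least one of the following two conditions hold: (i) $o(H)=\mathcal{R}$ and $\mathrm{diam}(H)\le 2$; (ii) $o(K_1\odot H)=\mathcal{R}$. Then $o(G\odot H)=\mathcal{R}$.
   Context: All graphs are finite and simple; $n(X)=|V(X)|$, $K_1$ is the one-vertex graph, and $\mathrm{diam}(X)$ is the largest shortest-path distance between two vertices of $X$. The corona product $G\odot H$ of a connected graph $G$ and a graph $H$ is obtained from one copy of $G$ and $n(G)$ disjoint copies of $H$ by joining the $i$-th vertex of $G$ to every vertex of the $i$-th copy of $H$. A set $W\subseteq V(X)$ of a connected graph $X$ is a resolving set of $X$ if for every two distinct vertices $x,y$ of $X$ there is $z\in W$ such that the shortest-path distances $d_X(x,z)$ and $d_X(y,z)$ differ. The Maker-Breaker resolving game on a connected graph $X$ is played by two players, Resolver and Spoiler, who alternately select a not yet played vertex of $X$. Resolver wins if he selects all the vertices of some resolving set of $X$; Spoiler wins if she prevents this, i.e. if she selects at least one vertex from every resolving set of $X$. The outcome $o(X)$ is: $\mathcal{R}$ if Resolver has a winning strategy no matter who starts the game; $\mathcal{S}$ if Spoiler has a winning strategy no matter who starts the game; $\mathcal{N}$ if the first player has a winning strategy (no matter which of the two players that is). -}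

module Defs where

open import Data.Empty using (⊥)
open import Data.Fin using (Fin)
open import Data.Fin.Properties using (+↔⊎; *↔×) renaming (_≟_ to _≟ᶠ_)
open import Data.List using (List; []; _∷_)
open import Data.List.Membership.Propositional using (_∈_; _∉_)
open import Data.List.Relation.Binary.Subset.Propositional using (_⊆_)
open import Data.Nat using (ℕ; zero; suc; _+_; _*_; _≤_)
open import Data.Product using (∃; ∃-syntax; _×_; _,_)
open import Data.Product.Function.NonDependent.Propositional using (_×-↔_)
open import Data.Sum using (_⊎_; inj₁; inj₂)
open import Data.Sum.Function.Propositional using (_⊎-↔_)
open import Function using (_↔_)
open import Function.Construct.Composition using (_↔-∘_)
open import Function.Construct.Identity using (↔-id)
open import Function.Construct.Symmetry using (↔-sym)
open import Function.Properties.Inverse using (↔⇒↣)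
open import Relation.Binary using (Rel; Decidable; DecidableEquality; Symmetric; Irreflexive)
open import Relation.Binary.PropositionalEquality using (_≡_; _≢_; refl)
open import Relation.Nullary using (yes; no)
open import Relation.Nullary.Decidable using (map′; via-injection)
open import Level using (0ℓ)

-- Finite simple graphs.  Finiteness is an explicit enumeration of the vertices.
record Graph : Set₁ where
  field
    V      : Set
    n      : ℕ
    enum   : V ↔ Fin n
    Adj    : Rel V 0ℓ
    adj?   : Decidable Adj
    sym    : Symmetric Adj
    irrefl : Irreflexive _≡_ Adj

  _≟_ : DecidableEquality V
  _≟_ = via-injection (↔⇒↣ enum) _≟ᶠ_

open Graph using (V; n)

K₁ : Graph
K₁ = record
  { V      = Fin 1
  ; n      = 1
  ; enum   = ↔-id (Fin 1)
  ; Adj    = λ _ _ → ⊥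
  ; adj?   = λ _ _ → no λ ()
  ; sym    = λ ()
  ; irrefl = λ _ ()
  }

-- inj₁ g is the vertex g of G; inj₂ (g , h) is the vertex h of the copy of H
-- attached to g.
module Corona (G H : Graph) where

  private
    module G = Graph G
    module H = Graph H

  Vertex : Set
  Vertex = G.V ⊎ (G.V × H.V)

  data Adj : Rel Vertex 0ℓ where
    base : ∀ {g g′} → G.Adj g g′ → Adj (inj₁ g) (inj₁ g′)
    copy : ∀ {g h h′} → H.Adj h h′ → Adj (inj₂ (g , h)) (inj₂ (g , h′))
    down : ∀ {g h} → Adj (inj₁ g) (inj₂ (g , h))
    up   : ∀ {g h} → Adj (inj₂ (g , h)) (inj₁ g)

  adj? : Decidable Adj
  adj? (inj₁ g) (inj₁ g′) = map′ base (λ { (base e) → e }) (G.adj? g g′)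
  adj? (inj₁ g) (inj₂ (g′ , h)) =
    map′ (λ { refl → down }) (λ { down → refl }) (g G.≟ g′)
  adj? (inj₂ (g , h)) (inj₁ g′) =
    map′ (λ { refl → up }) (λ { up → refl }) (g G.≟ g′)
  adj? (inj₂ (g , h)) (inj₂ (g′ , h′)) with g G.≟ g′
  ... | yes refl = map′ copy (λ { (copy e) → e }) (H.adj? h h′)
  ... | no g≢g′  = no λ { (copy _) → g≢g′ refl }

  sym : Symmetric Adj
  sym (base e) = base (G.sym e)
  sym (copy e) = copy (H.sym e)
  sym down     = up
  sym up       = down

  irrefl : Irreflexive _≡_ Adj
  irrefl refl (base e) = G.irrefl refl e
  irrefl refl (copy e) = H.irrefl refl e

  enum : Vertex ↔ Fin (G.n + G.n * H.n)
  enum = ↔-sym +↔⊎ ↔-∘ (G.enum ⊎-↔ (↔-sym *↔× ↔-∘ (G.enum ×-↔ H.enum)))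

infixr 7 _⊙_

_⊙_ : Graph → Graph → Graph
G ⊙ H = record { Corona G H renaming (Vertex to V) ; n = n G + n G * n H }

module _ (X : Graph) where

  open Graph X using (Adj)

  data Walk : V X → V X → ℕ → Set where
    []  : ∀ {x} → Walk x x zero
    _∷_ : ∀ {x y z k} → Adj x y → Walk y z k → Walk x z (suc k)

  Connected : Set
  Connected = ∀ x y → ∃[ k ] Walk x y k

  -- IsDist x y d means d_X(x,y) = d.  A shortest walk is a path, so the minimum
  -- over walks is the shortest-path distance.
  IsDist : V X → V X → ℕ → Set
  IsDist x y d = Walk x y d × (∀ {k} → Walk x y k → d ≤ k)

  IsDiam : ℕ → Set
  IsDiam D = (∃[ x ] ∃[ y ] IsDist x y D) × (∀ {x y d} → IsDist x y d → d ≤ D)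

  Resolves : V X → V X → V X → Set
  Resolves z x y = ∃[ d ] ∃[ d′ ] IsDist x z d × IsDist y z d′ × d ≢ d′

  -- Sets of vertices are given by lists, of which only membership is used.
  Resolving : List (V X) → Set
  Resolving W = ∀ {x y} → x ≢ y → ∃[ z ] z ∈ W × Resolves z x y

data Player : Set where
  resolver spoiler : Player

opponent : Player → Player
opponent resolver = spoiler
opponent spoiler  = resolver

module Game (X : Graph) where

  record Position : Set where
    constructor ⟨_,_⟩
    field
      byResolver bySpoiler : List (V X)

  open Position

  start : Position
  start = ⟨ [] , [] ⟩

  Unplayed : Position → V X → Set
  Unplayed p v = v ∉ byResolver p × v ∉ bySpoiler p

  play : Player → V X → Position → Position
  play resolver v ⟨ R , S ⟩ = ⟨ v ∷ R , S ⟩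
  play spoiler  v ⟨ R , S ⟩ = ⟨ R , v ∷ S ⟩

  Won : Player → Position → Set
  Won resolver p = ∃[ W ] Resolving X W × W ⊆ byResolver p
  Won spoiler  p = ∀ W → Resolving X W → ∃[ v ] v ∈ W × v ∈ bySpoiler p

  -- WinningStrategy P Q p is the type of winning strategies of P from position p
  -- with Q to move, as well-founded trees: one move at each turn of P, one subtree
  -- for every legal move at each turn of the opponent.  A won position remains won
  -- whatever is played later, so a branch may stop there.  The first argument of
  -- reply prevents P from winning vacuously when no vertex is left.
  data WinningStrategy (P : Player) : Player → Position → Set where
    won   : ∀ {Q p} → Won P p → WinningStrategy P Q p
    move  : ∀ {p} v → Unplayed p v →
            WinningStrategy P (opponent P) (play P v p) →
            WinningStrategy P P p
    reply : ∀ {p} → ∃ (Unplayed p) →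
            (∀ v → Unplayed p v →
              WinningStrategy P P (play (opponent P) v p)) →
            WinningStrategy P (opponent P) p

data Outcome : Set where
  𝓡 𝓢 𝓝 : Outcome

-- HasOutcome X o means o(X) = o.
HasOutcome : Graph → Outcome → Set
HasOutcome X 𝓡 = ∀ first → Game.WinningStrategy X resolver first (Game.start X)
HasOutcome X 𝓢 = ∀ first → Game.WinningStrategy X spoiler first (Game.start X)
HasOutcome X 𝓝 = ∀ first → Game.WinningStrategy X first first (Game.start X)

{-# OPTIONS --safe #-}
-- Resolver plays as second player in all copies H_g (case (i)) or all blocks
-- {g} ∪ H_g (case (ii)) simultaneously, answering each move of Spoiler where it was
-- made; an additional vertex never hurts him.  So he ends up with a non-empty set W_g
-- in every block that separates the vertices of the copy (block), both kinds of
-- subgraphs being isometric in G ⊙ H.  In case (i) g and h ∈ H_g are separated by any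
-- z outside the block, since a walk from h to z passes through g.  Vertices x and y of
-- different blocks g and g′ are separated too: a walk from y to z ∈ W_g passes through
-- g′ and g, so d(x,z) = d(y,z) forces d(x,g) > d(y,g′), and z′ ∈ W_g′ gives the converse.
module Submission where

open import Data.Empty using (⊥-elim)
open import Data.Fin using (Fin; zero; suc)
open import Data.Fin.Properties using (any?)
open import Data.List using (List; []; _∷_; length; map; filter; allFin)
open import Data.List.Membership.Propositional using (_∈_; lose)
open import Data.List.Membership.Propositional.Properties using (∈-map⁺; ∈-allFin; ∈-filter⁺)
import Data.List.Membership.DecPropositional as DecMembership
open import Data.List.Properties using (filter-notAll)
open import Data.List.Relation.Unary.Any as Any using (here; there; satisfied)
open import Data.Nat using (ℕ; zero; suc; _+_; _≤_; _<_; z≤n; s≤s) renaming (_≟_ to _≟ℕ_)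
open import Data.Nat.Induction using (<-wellFounded)
open import Data.Nat.Properties
  using (≤-refl; ≤-trans; ≮⇒≥; m≤n⇒m≤1+n; anyUpTo?; +-cancelʳ-<; <-≤-trans; ≤-<-trans;
         m≤n+m; <-asym; <-irrefl)
open import Data.Product using (∃; ∃-syntax; _×_; _,_; proj₁; proj₂)
open import Data.Sum using (_⊎_; inj₁; inj₂)
open import Data.Sum.Properties using (inj₂-injective)
open import Function using (_∘_; Inverse)
open import Function.Definitions using (Injective)
open import Induction.WellFounded using (Acc; acc)
open import Relation.Binary using (DecidableEquality)
open import Relation.Binary.PropositionalEquality
  using (_≡_; _≢_; refl; sym; trans; cong; subst; subst₂; ≢-sym)
open import Relation.Nullary using (Dec; yes; no; ¬?; contradiction)
open import Relation.Nullary.Decidable using (map′; _×-dec_)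
import Relation.Unary as U
open import Defs

open Graph using (V; n; Adj)

-- Finite graphs and distances

infixr 5 _++ʷ_
_++ʷ_ : ∀ {X x y z j k} → Walk X x y j → Walk X y z k → Walk X x z (j + k)
[]      ++ʷ w′ = w′
(e ∷ w) ++ʷ w′ = e ∷ (w ++ʷ w′)

module _ (X : Graph) where

  open Graph X using (enum; adj?; _≟_)
  open Inverse enum using (to; from; strictlyInverseˡ; strictlyInverseʳ)

  vertices : List (V X)
  vertices = map from (allFin (n X))

  ∈-vertices : ∀ v → v ∈ vertices
  ∈-vertices v = subst (_∈ vertices) (strictlyInverseʳ v) (∈-map⁺ from (∈-allFin (to v)))

  anyVertex? : {P : V X → Set} → U.Decidable P → Dec (∃ P)
  anyVertex? {P} P? = map′
    (λ (i , p) → from i , p)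
    (λ (x , p) → to x , subst P (sym (strictlyInverseʳ x)) p)
    (any? (P? ∘ from))

  otherIndex : ∀ {m} → 2 ≤ m → (i : Fin m) → ∃[ j ] j ≢ i
  otherIndex (s≤s (s≤s _)) zero    = suc zero , λ ()
  otherIndex (s≤s (s≤s _)) (suc _) = zero , λ ()

  otherVertex : 2 ≤ n X → ∀ x → ∃[ y ] y ≢ x
  otherVertex 2≤n x with otherIndex 2≤n (to x)
  ... | j , j≢x = from j , λ eq → j≢x (trans (sym (strictlyInverseˡ j)) (cong to eq))

  someVertex : 2 ≤ n X → V X
  someVertex (s≤s _) = from zero

  walk? : ∀ k x y → Dec (Walk X x y k)
  walk? zero x y = map′ (λ { refl → [] }) (λ { [] → refl }) (x ≟ y)
  walk? (suc k) x y = map′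
    (λ (_ , e , w) → e ∷ w)
    (λ { (e ∷ w) → _ , e , w })
    (anyVertex? λ z → adj? x z ×-dec walk? k z y)

  -- Descent on the length: `walk?` decides whether a shorter walk exists, and when none does the
  -- current one realises the distance.
  walk⇒dist : ∀ {x y k} → Walk X x y k → ∃[ d ] IsDist X x y d
  walk⇒dist {x} {y} {k} w = go (<-wellFounded k) w
    where
    go : ∀ {k} → Acc _<_ k → Walk X x y k → ∃[ d ] IsDist X x y d
    go {k} (acc rs) w with anyUpTo? (λ j → walk? j x y) k
    ... | yes (j , j<k , w′) = go (rs j<k) w′
    ... | no none = k , w , λ {j} w′ → ≮⇒≥ λ j<k → none (j , j<k , w′)

  Resolves-sym : ∀ {z x y} → Resolves X z x y → Resolves X z y x
  Resolves-sym (d , d′ , p , q , d≢d′) = d′ , d , q , p , ≢-sym d≢d′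

  Resolving⇒nonempty : ∀ {W x y} → x ≢ y → Resolving X W → ∃[ z ] z ∈ W
  Resolving⇒nonempty x≢y res with res x≢y
  ... | z , z∈W , _ = z , z∈W

  resolves-or-equidistant : Connected X → ∀ z x y →
    Resolves X z x y ⊎ (∃[ d ] IsDist X x z d × IsDist X y z d)
  resolves-or-equidistant conn z x y
    with walk⇒dist (proj₂ (conn x z)) | walk⇒dist (proj₂ (conn y z))
  ... | d , p | d′ , q with d ≟ℕ d′
  ...   | yes refl = inj₂ (d , p , q)
  ...   | no d≢d′  = inj₁ (d , d′ , p , q , d≢d′)

-- Isometric maps and retractions

module _ (X Y : Graph) where

  IsIsometric : (V X → V Y) → Set
  IsIsometric f = ∀ {x y d} → IsDist X x y d → IsDist Y (f x) (f y) d

  Resolves-isometric : ∀ {f} → IsIsometric f → ∀ {z x y} →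
    Resolves X z x y → Resolves Y (f z) (f x) (f y)
  Resolves-isometric iso (d , d′ , p , q , d≢d′) = d , d′ , iso p , iso q , d≢d′

  mapWalk : {f : V X → V Y} → (∀ {x y} → Adj X x y → Adj Y (f x) (f y)) →
    ∀ {x y k} → Walk X x y k → Walk Y (f x) (f y) k
  mapWalk hom []      = []
  mapWalk hom (e ∷ w) = hom e ∷ mapWalk hom w

  -- Contracted edges are dropped from the image walk, so it can only get shorter.
  collapseWalk : {f : V X → V Y} → (∀ {x y} → Adj X x y → Adj Y (f x) (f y) ⊎ f x ≡ f y) →
    ∀ {x y k} → Walk X x y k → ∃[ j ] j ≤ k × Walk Y (f x) (f y) j
  collapseWalk weak [] = 0 , z≤n , []
  collapseWalk {f} weak {y = y} (e ∷ w) with weak e | collapseWalk weak w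
  ... | inj₁ e′ | j , j≤k , w′ = suc j , s≤s j≤k , e′ ∷ w′
  ... | inj₂ eq | j , j≤k , w′ =
    j , m≤n⇒m≤1+n j≤k , subst (λ x → Walk Y x (f y) j) (sym eq) w′

-- `f` carries walks of `X` to walks of `Y`, so distances do not grow; `r` folds any walk of `Y`
-- back to one of `X` that is no longer, so they do not shrink.
retract⇒isometric : (X Y : Graph) {f : V X → V Y} {r : V Y → V X} →
  (∀ {x y} → Adj X x y → Adj Y (f x) (f y)) →
  (∀ {x y} → Adj Y x y → Adj X (r x) (r y) ⊎ r x ≡ r y) →
  (∀ x → r (f x) ≡ x) →
  IsIsometric X Y f
retract⇒isometric X Y {f} {r} hom weak r∘f {x} {y} {d} (w , min) =
  mapWalk X Y hom w , shortest
  where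
  shortest : ∀ {k} → Walk Y (f x) (f y) k → d ≤ k
  shortest w′ with collapseWalk Y X weak w′
  ... | j , j≤k , w″ =
    ≤-trans (min (subst₂ (λ x y → Walk X x y j) (r∘f x) (r∘f y) w″)) j≤k

-- Playing many copies of a game simultaneously

-- The block of `i` is the image of `ι (i , _)`. Injectivity of `ι` makes the blocks disjoint, so a
-- move touches at most one local game. Vertices outside all blocks are allowed: in case (i) these
-- are the vertices of `G`.
module SimultaneousGame
  (X Y : Graph) {I : Set} (_≟ᴵ_ : DecidableEquality I)
  (ι : I × V X → V Y) (ι-injective : Injective _≡_ _≡_ ι)
  (image? : ∀ y → Dec (∃[ iu ] ι iu ≡ y))
  (assemble : ∀ {R} →
    (∀ i → ∃[ W ] Resolving X W × (∀ {u} → u ∈ W → ι (i , u) ∈ R)) → Resolving Y R)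
  where

  private
    module GX = Game X
    module GY = Game Y
    open GX using (won; move; reply)

  open GY using (play)
  open GX.Position renaming (byResolver to Rˣ; bySpoiler to Sˣ)
  open GY.Position renaming (byResolver to Rʸ; bySpoiler to Sʸ)
  open Graph Y using (_≟_)
  open DecMembership _≟_ using (_∈?_)
  open DecMembership (Graph._≟_ X) using () renaming (_∈?_ to _∈ˣ?_)

  -- The actual position may be better for Resolver than the one in which the local
  -- strategy believes to be: this absorbs his additional moves.
  record Local (p : GY.Position) (i : I) : Set where
    constructor local
    field
      {pos}    : GX.Position
      strategy : GX.WinningStrategy resolver spoiler pos
      owned    : ∀ {u} → u ∈ Rˣ pos → ι (i , u) ∈ Rʸ p
      lost     : ∀ {u} → ι (i , u) ∈ Sʸ p → u ∈ Sˣ pos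

  Locals : GY.Position → Set
  Locals p = ∀ i → Local p i

  -- `vs` bounds the unplayed vertices from above; its length decreases with every move and serves
  -- as the termination measure.
  Covers : List (V Y) → GY.Position → Set
  Covers vs p = ∀ {v} → GY.Unplayed p v → v ∈ vs

  Full : GY.Position → Set
  Full p = ∀ v → v ∈ Rʸ p ⊎ v ∈ Sʸ p

  resolverPlays : ∀ {p i} v → Local p i → Local (play resolver v p) i
  resolverPlays v (local t o l) = local t (there ∘ o) l

  spoilerPlaysElsewhere : ∀ {p v i} → (∀ u → ι (i , u) ≢ v) →
    Local p i → Local (play spoiler v p) i
  spoilerPlaysElsewhere ≢v (local t o l) =
    local t o λ { (here eq) → ⊥-elim (≢v _ eq) ; (there m) → l m }

  insertAt : ∀ {p} i → Local p i → (∀ j → j ≢ i → Local p j) → Locals p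
  insertAt i ℓ others j with j ≟ᴵ i
  ... | yes refl = ℓ
  ... | no j≢i   = others j j≢i

  lost∷ : ∀ {i u S T} → (∀ {w} → ι (i , w) ∈ T → w ∈ S) →
    ∀ {w} → ι (i , w) ∈ ι (i , u) ∷ T → w ∈ u ∷ S
  lost∷ l (here eq) = here (cong proj₂ (ι-injective eq))
  lost∷ l (there m) = there (l m)

  -- On a full board the local strategy is run to its end against an imagined Spoiler;
  -- it only ever asks for vertices that Resolver owns.
  full⇒local-won : ∀ {p i} → Full p → Local p i →
    ∃[ W ] Resolving X W × (∀ {u} → u ∈ W → ι (i , u) ∈ Rʸ p)
  full⇒local-won {p} {i} full (local t o l) = go t o l
    where
    go : ∀ {q} → GX.WinningStrategy resolver spoiler q →
      (∀ {u} → u ∈ Rˣ q → ι (i , u) ∈ Rʸ p) → (∀ {u} → ι (i , u) ∈ Sʸ p → u ∈ Sˣ q) →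
      ∃[ W ] Resolving X W × (∀ {u} → u ∈ W → ι (i , u) ∈ Rʸ p)
    go (won (W , res , W⊆R)) o l = W , res , o ∘ W⊆R
    go (reply (v , v-free) next) o l with next v v-free
    ... | won (W , res , W⊆R) = W , res , o ∘ W⊆R
    ... | move w (_ , w∉S) t′ with full (ι (i , w))
    ...   | inj₂ ιw∈S = contradiction (there (l ιw∈S)) w∉S
    ...   | inj₁ ιw∈R = go t′ (λ { (here refl) → ιw∈R ; (there m) → o m }) (there ∘ l)

  full⇒won : ∀ {p} → Full p → Locals p → GY.Won resolver p
  full⇒won full L = _ , assemble (λ i → full⇒local-won full (L i)) , λ m → m

  unplayed-or-full : ∀ {p} vs → Covers vs p → ∃ (GY.Unplayed p) ⊎ Full p
  unplayed-or-full {p} vs cov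
    with Any.any? (λ v → ¬? (v ∈? Rʸ p) ×-dec ¬? (v ∈? Sʸ p)) vs
  ... | yes a = inj₁ (satisfied a)
  ... | no none = inj₂ full
    where
    full : Full p
    full v with v ∈? Rʸ p | v ∈? Sʸ p
    ... | yes v∈R | _       = inj₁ v∈R
    ... | no _    | yes v∈S = inj₂ v∈S
    ... | no v∉R  | no v∉S  = contradiction (lose (cov (v∉R , v∉S)) (v∉R , v∉S)) none

  _without_ : List (V Y) → V Y → List (V Y)
  vs without v = filter (λ u → ¬? (u ≟ v)) vs

  without-shorter : ∀ {vs v} → v ∈ vs → length (vs without v) < length vs
  without-shorter {vs} v∈vs =
    filter-notAll _ vs (Any.map (λ v≡u u≢v → u≢v (sym v≡u)) v∈vs)

  covers-play : ∀ {vs p v} P → Covers vs p → Covers (vs without v) (play P v p)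
  covers-play resolver cov (u∉R , u∉S) =
    ∈-filter⁺ _ (cov (u∉R ∘ there , u∉S)) (u∉R ∘ here)
  covers-play spoiler cov (u∉R , u∉S) =
    ∈-filter⁺ _ (cov (u∉R , u∉S ∘ there)) (u∉S ∘ here)

  -- Resolver's strategy on the whole board

  mutual

    resolverToMove : ∀ {p} vs → Covers vs p → Acc _<_ (length vs) → Locals p →
      GY.WinningStrategy resolver resolver p
    resolverToMove vs cov ac L with unplayed-or-full vs cov
    ... | inj₂ full         = GY.won (full⇒won full L)
    -- No local game awaits an answer here, so any free vertex will do: it only enlarges Resolver's
    -- set.
    ... | inj₁ (v , v-free) = resolverMoves vs cov ac v v-free (resolverPlays v ∘ L)

    resolverMoves : ∀ {p} vs → Covers vs p → Acc _<_ (length vs) →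
      ∀ v → GY.Unplayed p v → Locals (play resolver v p) →
      GY.WinningStrategy resolver resolver p
    resolverMoves vs cov (acc rs) v v-free L = GY.move v v-free
      (spoilerToMove (vs without v) (covers-play resolver cov)
        (rs (without-shorter (cov v-free))) L)

    spoilerToMove : ∀ {p} vs → Covers vs p → Acc _<_ (length vs) → Locals p →
      GY.WinningStrategy resolver spoiler p
    spoilerToMove vs cov (acc rs) L with unplayed-or-full vs cov
    ... | inj₂ full = GY.won (full⇒won full L)
    ... | inj₁ free = GY.reply free λ v v-free →
      respond (vs without v) v (covers-play spoiler cov) (rs (without-shorter (cov v-free)))
        v-free L

    respond : ∀ {p} vs v → Covers vs (play spoiler v p) → Acc _<_ (length vs) →
      GY.Unplayed p v → Locals p →
      GY.WinningStrategy resolver resolver (play spoiler v p)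
    respond vs v cov ac v-free L with image? v
    -- A vertex outside all blocks changes no local game, which leaves Resolver an additional move.
    ... | no ∉image =
      resolverToMove vs cov ac λ i → spoilerPlaysElsewhere (λ u eq → ∉image (_ , eq)) (L i)
    ... | yes ((i , u) , refl) = respondInBlock vs i u cov ac v-free (L i)
      λ j j≢i → spoilerPlaysElsewhere (λ _ eq → j≢i (cong proj₁ (ι-injective eq))) (L j)

    respondInBlock : ∀ {p} vs i u → let p′ = play spoiler (ι (i , u)) p in
      Covers vs p′ → Acc _<_ (length vs) → GY.Unplayed p (ι (i , u)) →
      Local p i → (∀ j → j ≢ i → Local p′ j) →
      GY.WinningStrategy resolver resolver p′
    -- This local game is won and stays won; Spoiler's move is recorded in it to maintain `lost`.
    respondInBlock vs i u cov ac _ (local {q} (won w) o l) others =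
      resolverToMove vs cov ac
        (insertAt i (local {pos = GX.play spoiler u q} (won w) o (lost∷ l)) others)
    respondInBlock {p} vs i u cov ac (ιu∉R , _) (local {q} t@(reply _ next) o l) others
      with u ∈ˣ? Sˣ q
    -- `lost` is only an inclusion, so the local position may already credit `u` to Spoiler; then it
    -- stays as it is.
    ... | yes u∈S =
      resolverToMove vs cov ac (insertAt i (local t o (absorb ∘ lost∷ l)) others)
      where
      absorb : ∀ {w} → w ∈ u ∷ Sˣ q → w ∈ Sˣ q
      absorb (here refl) = u∈S
      absorb (there m)   = m
    ... | no u∉S with next u (ιu∉R ∘ o , u∉S)
    ...   | won w =
      resolverToMove vs cov ac
        (insertAt i (local {pos = GX.play spoiler u q} (won w) o (lost∷ l)) others)
    ...   | move w (_ , w∉S) t′ with ι (i , w) ∈? Rʸ p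
    -- The prescribed answer is already Resolver's on the real board. The local game advances as if
    -- it were played now, and the real move is free.
    ...     | yes ιw∈R =
      resolverToMove vs cov ac
        (insertAt i (local t′ (λ { (here refl) → ιw∈R ; (there m) → o m }) (lost∷ l)) others)
    ...     | no ιw∉R =
      resolverMoves vs cov ac (ι (i , w)) (ιw∉R , w∉S ∘ lost∷ l)
        (insertAt i
          (local t′ (λ { (here refl) → here refl ; (there m) → there (o m) }) (lost∷ l))
          (λ j j≢i → resolverPlays _ (others j j≢i)))

  initialLocals : GX.WinningStrategy resolver spoiler GX.start → Locals GY.start
  initialLocals t i = local t (λ ()) (λ ())

  -- Playing second in every block suffices for both starting players: if Resolver starts, his first
  -- move is an additional one.
  resolver-wins : GX.WinningStrategy resolver spoiler GX.start → HasOutcome Y 𝓡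
  resolver-wins t resolver =
    resolverToMove (vertices Y) (λ _ → ∈-vertices Y _) (<-wellFounded _) (initialLocals t)
  resolver-wins t spoiler =
    spoilerToMove (vertices Y) (λ _ → ∈-vertices Y _) (<-wellFounded _) (initialLocals t)

-- Coronas

module CoronaGame (G H : Graph) (G-connected : Connected G) where

  private
    module G = Graph G
    Y : Graph
    Y = G ⊙ H

  open Corona G H using (base; copy; down; up)

  -- Roots of blocks and walks between blocks

  root : V Y → V G
  root (inj₁ g)       = g
  root (inj₂ (g , _)) = g

  toRoot : ∀ y → ∃[ k ] Walk Y y (inj₁ (root y)) k
  toRoot (inj₁ g) = 0 , []
  toRoot (inj₂ _) = 1 , up ∷ []

  fromRoot : ∀ y → ∃[ k ] Walk Y (inj₁ (root y)) y k
  fromRoot (inj₁ g) = 0 , []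
  fromRoot (inj₂ _) = 1 , down ∷ []

  corona-connected : Connected Y
  corona-connected x y =
    _ , proj₂ (toRoot x)
      ++ʷ mapWalk G Y base (proj₂ (G-connected (root x) (root y)))
      ++ʷ proj₂ (fromRoot y)

  -- A copy can be left only by an `up` edge to its root; that edge makes the remaining walk
  -- strictly shorter.
  leaveCopy : ∀ {g h z k} → Walk Y (inj₂ (g , h)) z k → root z ≢ g →
    ∃[ j ] j < k × Walk Y (inj₁ g) z j
  leaveCopy []            z≢g = contradiction refl z≢g
  leaveCopy (up ∷ w)      z≢g = _ , ≤-refl , w
  leaveCopy (copy _ ∷ w)  z≢g with leaveCopy w z≢g
  ... | j , j<k , w′ = j , m≤n⇒m≤1+n j<k , w′

  -- The walk must visit both roots, and at least one edge between the two distinct roots gives the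
  -- strict inequality.
  crossing : ∀ {y z k} → Walk Y y z k → root y ≢ root z →
    ∃[ a ] ∃[ b ] Walk Y y (inj₁ (root y)) a × Walk Y (inj₁ (root z)) z b × a + b < k
  crossing [] y≢z = contradiction refl y≢z
  crossing {z = z} (base {g′ = g′} e ∷ w) y≢z with g′ G.≟ root z
  ... | yes refl = 0 , _ , [] , w , ≤-refl
  ... | no g′≢z with crossing w g′≢z
  ...   | a , b , _ , w″ , a+b<k = 0 , b , [] , w″ , m≤n⇒m≤1+n (≤-<-trans (m≤n+m b a) a+b<k)
  crossing (copy e ∷ w) y≢z with crossing w y≢z
  ... | a , b , w′ , w″ , a+b<k = suc a , b , copy e ∷ w′ , w″ , s≤s a+b<k
  crossing (down ∷ w) y≢z with crossing w y≢z
  -- The walk starts at its root, so the empty walk replaces the initial part.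
  ... | a , b , w′ , w″ , a+b<k = 0 , b , [] , w″ , m≤n⇒m≤1+n (≤-<-trans (m≤n+m b a) a+b<k)
  crossing (up ∷ w) y≢z with crossing w y≢z
  ... | a , b , w′ , w″ , a+b<k = _ , b , up ∷ w′ , w″ , s≤s a+b<k

  -- Split a shortest walk from `y` to `z` by `crossing`, with final part of length `c` from the
  -- root of `z`. Going from `x` to that root and then along this part gives `b′ + c < d ≤ a + c`,
  -- hence `b ≤ b′ < a`.
  farther-from-root : ∀ {x y z a b d} → root x ≡ root z → root y ≢ root z →
    IsDist Y x z d → IsDist Y y z d →
    IsDist Y x (inj₁ (root x)) a → IsDist Y y (inj₁ (root y)) b → b < a
  farther-from-root {x} {a = a} x~z y≢z (_ , min-xz) (w , _) (v , _) (_ , min-y)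
    with crossing w y≢z
  ... | b′ , c , w′ , w″ , b′+c<d =
    ≤-<-trans (min-y w′)
      (+-cancelʳ-< c b′ a (<-≤-trans b′+c<d (min-xz (v′ ++ʷ w″))))
    where
    v′ : Walk Y x (inj₁ _) a
    v′ = subst (λ g → Walk Y x (inj₁ g) a) x~z v

  corona-resolving : ∀ {R} →
    (∀ g → ∃[ z ] z ∈ R × root z ≡ g) →
    (∀ {x y} → root x ≡ root y → x ≢ y → ∃[ z ] z ∈ R × Resolves Y z x y) →
    Resolving Y R
  corona-resolving meets within {x} {y} x≢y with root x G.≟ root y
  ... | yes eq = within eq x≢y
  ... | no x≁y with meets (root x) | meets (root y)
  ...   | z , z∈R , z~x | z′ , z′∈R , z′~y
      with resolves-or-equidistant Y corona-connected z x y
         | resolves-or-equidistant Y corona-connected z′ x y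
  ...     | inj₁ r | _      = z , z∈R , r
  ...     | inj₂ _ | inj₁ r = z′ , z′∈R , r
  ...     | inj₂ (_ , p , q) | inj₂ (_ , p′ , q′)
      with walk⇒dist Y (proj₂ (toRoot x)) | walk⇒dist Y (proj₂ (toRoot y))
  -- If neither `z` nor `z′` resolves the pair, each of `x` and `y` is strictly farther from its
  -- root than the other.
  ...       | _ , dx | _ , dy = contradiction
    (farther-from-root (sym z~x) (λ y~z → x≁y (sym (trans y~z z~x))) p q dx dy)
    (<-asym (farther-from-root (sym z′~y) (λ x~z′ → x≁y (trans x~z′ z′~y)) q′ p′ dy dx))

  -- Were the distances equal, a shortest walk from the copy vertex would contain, by `leaveCopy`, a
  -- walk from `g` shorter than that distance.
  resolves-root : ∀ {g h z} → root z ≢ g → Resolves Y z (inj₁ g) (inj₂ (g , h))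
  resolves-root {g} {h} {z} z≢g
    with resolves-or-equidistant Y corona-connected z (inj₁ g) (inj₂ (g , h))
  ... | inj₁ r = r
  ... | inj₂ (_ , (_ , min) , (w , _)) with leaveCopy w z≢g
  ...   | _ , j<d , w′ = contradiction (<-≤-trans j<d (min w′)) (<-irrefl refl)

  -- Case (i)

  inCopy : V G × V H → V Y
  inCopy = inj₂

  inCopy-isometric : ∀ {D} → IsDiam H D → D ≤ 2 → ∀ g → IsIsometric H Y (λ h → inCopy (g , h))
  inCopy-isometric (_ , diam) D≤2 g {x} {y} {d} dist@(w , min) = mapWalk H Y copy w , shortest
    where
    shortest : ∀ {k} → Walk Y (inj₂ (g , x)) (inj₂ (g , y)) k → d ≤ k
    shortest []            = min []
    shortest (copy e ∷ []) = min (e ∷ [])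
    -- A detour through the root has length at least 2, which the diameter of `H` does not exceed.
    shortest (_ ∷ _ ∷ _)   = ≤-trans (diam dist) (≤-trans D≤2 (s≤s (s≤s z≤n)))

  inCopy-image? : ∀ y → Dec (∃[ gh ] inCopy gh ≡ y)
  inCopy-image? (inj₁ _)  = no λ ()
  inCopy-image? (inj₂ gh) = yes (gh , refl)

  module _ (2≤nG : 2 ≤ n G) (2≤nH : 2 ≤ n H) {D} (diam : IsDiam H D) (D≤2 : D ≤ 2) where

    assembleCopies : ∀ {R} →
      (∀ g → ∃[ W ] Resolving H W × (∀ {h} → h ∈ W → inCopy (g , h) ∈ R)) → Resolving Y R
    assembleCopies {R} locally = corona-resolving meets within
      where
      meets : ∀ g → ∃[ z ] z ∈ R × root z ≡ g
      meets g with locally g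
      ... | _ , res , W⊆R
        -- Two distinct vertices of `H` have to be resolved, so `W` is non-empty.
        with Resolving⇒nonempty H (proj₂ (otherVertex H 2≤nH (someVertex H 2≤nH))) res
      ...   | h , h∈W = inCopy (g , h) , W⊆R h∈W , refl

      root-vs-copy : ∀ g h → ∃[ z ] z ∈ R × Resolves Y z (inj₁ g) (inj₂ (g , h))
      root-vs-copy g h with otherVertex G 2≤nG g
      ... | g′ , g′≢g with meets g′
      ...   | z , z∈R , z~g′ = z , z∈R , resolves-root λ z~g → g′≢g (trans (sym z~g′) z~g)

      within : ∀ {x y} → root x ≡ root y → x ≢ y → ∃[ z ] z ∈ R × Resolves Y z x y
      within {inj₁ _}       {inj₁ _}       refl x≢y = contradiction refl x≢y
      within {inj₁ g}       {inj₂ (_ , h)} refl x≢y = root-vs-copy g h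
      within {inj₂ (g , h)} {inj₁ _}       refl x≢y with root-vs-copy g h
      ... | z , z∈R , r = z , z∈R , Resolves-sym Y r
      within {inj₂ (g , _)} {inj₂ (_ , _)} refl x≢y with locally g
      ... | _ , res , W⊆R with res (x≢y ∘ cong (λ h → inCopy (g , h)))
      ...   | h , h∈W , r =
        inCopy (g , h) , W⊆R h∈W ,
        Resolves-isometric H Y (inCopy-isometric diam D≤2 g) r

    copies-𝓡 : HasOutcome H 𝓡 → HasOutcome Y 𝓡
    copies-𝓡 o = SimultaneousGame.resolver-wins H Y G._≟_
      inCopy inj₂-injective inCopy-image? assembleCopies (o spoiler)

  -- Case (ii)

  private
    B : Graph
    B = K₁ ⊙ H
    module B = Corona K₁ H

  inBlock : V G × V B → V Y
  inBlock (g , inj₁ _)       = inj₁ g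
  inBlock (g , inj₂ (_ , h)) = inj₂ (g , h)

  inBlock-injective : Injective _≡_ _≡_ inBlock
  inBlock-injective {_ , inj₁ zero}       {_ , inj₁ zero}       refl = refl
  inBlock-injective {_ , inj₂ (zero , _)} {_ , inj₂ (zero , _)} refl = refl

  inBlock-image? : ∀ y → Dec (∃[ gb ] inBlock gb ≡ y)
  inBlock-image? (inj₁ g)       = yes ((g , inj₁ zero) , refl)
  inBlock-image? (inj₂ (g , h)) = yes ((g , inj₂ (zero , h)) , refl)

  root-inBlock : ∀ g b → root (inBlock (g , b)) ≡ g
  root-inBlock g (inj₁ _) = refl
  root-inBlock g (inj₂ _) = refl

  local-vertex : ∀ y → ∃[ b ] inBlock (root y , b) ≡ y
  local-vertex (inj₁ _)       = inj₁ zero , refl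
  local-vertex (inj₂ (_ , h)) = inj₂ (zero , h) , refl

  -- Everything outside the copy at `g` goes to the vertex of `K₁`, so each edge of `Y` is kept or
  -- contracted.
  retractToBlock : V G → V Y → V B
  retractToBlock g (inj₁ _) = inj₁ zero
  retractToBlock g (inj₂ (g′ , h)) with g′ G.≟ g
  ... | yes _ = inj₂ (zero , h)
  ... | no _  = inj₁ zero

  retract-inBlock : ∀ g b → retractToBlock g (inBlock (g , b)) ≡ b
  retract-inBlock g (inj₁ zero) = refl
  retract-inBlock g (inj₂ (zero , h)) with g G.≟ g
  ... | yes _  = refl
  ... | no g≢g = contradiction refl g≢g

  inBlock-adj : ∀ g {b c} → Adj B b c → Adj Y (inBlock (g , b)) (inBlock (g , c))
  inBlock-adj g (B.copy e) = copy e
  inBlock-adj g B.down     = down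
  inBlock-adj g B.up       = up

  retract-adj : ∀ g {x y} → Adj Y x y →
    Adj B (retractToBlock g x) (retractToBlock g y) ⊎ retractToBlock g x ≡ retractToBlock g y
  retract-adj g (base _) = inj₂ refl
  retract-adj g (copy {g = g′} e) with g′ G.≟ g
  ... | yes _ = inj₁ (B.copy e)
  ... | no _  = inj₂ refl
  retract-adj g (down {g = g′}) with g′ G.≟ g
  ... | yes _ = inj₁ B.down
  ... | no _  = inj₂ refl
  retract-adj g (up {g = g′}) with g′ G.≟ g
  ... | yes _ = inj₁ B.up
  ... | no _  = inj₂ refl

  inBlock-isometric : ∀ g → IsIsometric B Y (λ b → inBlock (g , b))
  inBlock-isometric g =
    retract⇒isometric B Y {r = retractToBlock g} (inBlock-adj g) (retract-adj g) (retract-inBlock g)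

  module _ (h₀ : V H) where

    assembleBlocks : ∀ {R} →
      (∀ g → ∃[ W ] Resolving B W × (∀ {b} → b ∈ W → inBlock (g , b) ∈ R)) → Resolving Y R
    assembleBlocks {R} locally = corona-resolving meets within
      where
      meets : ∀ g → ∃[ z ] z ∈ R × root z ≡ g
      meets g with locally g
      ... | _ , res , W⊆R
        -- The root and the copy vertex `h₀` form a pair to be resolved, so `W` is non-empty.
        with Resolving⇒nonempty B {x = inj₁ zero} {y = inj₂ (zero , h₀)} (λ ()) res
      ...   | b , b∈W = inBlock (g , b) , W⊆R b∈W , root-inBlock g b

      within-block : ∀ g {b c} → b ≢ c →
        ∃[ z ] z ∈ R × Resolves Y z (inBlock (g , b)) (inBlock (g , c))
      within-block g b≢c with locally g
      ... | _ , res , W⊆R with res b≢c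
      ...   | b , b∈W , r =
        inBlock (g , b) , W⊆R b∈W , Resolves-isometric B Y (inBlock-isometric g) r

      within : ∀ {x y} → root x ≡ root y → x ≢ y → ∃[ z ] z ∈ R × Resolves Y z x y
      within {x} {y} x~y x≢y with local-vertex x | local-vertex y
      ... | b , b≡x | c , c≡y = subst₂ (λ x y → ∃[ z ] z ∈ R × Resolves Y z x y) b≡x c≡y′
        (within-block (root x) λ b≡c → x≢y
          (trans (sym b≡x) (trans (cong (λ b → inBlock (root x , b)) b≡c) c≡y′)))
        where
        c≡y′ : inBlock (root x , c) ≡ y
        c≡y′ = trans (cong (λ g → inBlock (g , c)) x~y) c≡y

    blocks-𝓡 : HasOutcome B 𝓡 → HasOutcome Y 𝓡
    blocks-𝓡 o = SimultaneousGame.resolver-wins B Y G._≟_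
      inBlock inBlock-injective inBlock-image? assembleBlocks (o spoiler)

theorem3p6 : (G H : Graph) → Connected G → Connected H →
    2 ≤ Graph.n G → 2 ≤ Graph.n H →
    (HasOutcome H 𝓡 × (∃[ D ] (IsDiam H D × D ≤ 2))) ⊎ HasOutcome (K₁ ⊙ H) 𝓡 →
    HasOutcome (G ⊙ H) 𝓡
theorem3p6 G H G-connected _ 2≤nG 2≤nH (inj₁ (o , _ , diam , D≤2)) =
  CoronaGame.copies-𝓡 G H G-connected 2≤nG 2≤nH diam D≤2 o
theorem3p6 G H G-connected _ 2≤nG 2≤nH (inj₂ o) =
  CoronaGame.blocks-𝓡 G H G-connected (someVertex H 2≤nH) o
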